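{- We have the $\mathrm{des}$-Wilf equivalence $\underline{134}2\overset{\mathrm{des}}{\sim}\underline{124}3$.
   Context: $\mathfrak{S}_n$ is the set of permutations of $\{1,\ldots,n\}$ in one-line notation, and $\mathrm{des}(\pi)=|\{i\in[n-1]:\pi_i>\pi_{i+1}\}|$. An occurrence of the pattern $\underline{abc}d$ (where $abcd\in\mathfrak{S}_4$) in $\pi$ is a subsequence $\pi_i\pi_{i+1}\pi_{i+2}\pi_j$ with $j>i+2$ order-isomorphic to $abcd$. $\mathfrak{S}_n(\omega)$ is the set of permutations in $\mathfrak{S}_n$ with no occurrence of $\omega$. $\omega\overset{\mathrm{des}}{\sim}\omega'$ means $|\{\pi\in\mathfrak{S}_n(\omega):\mathrm{des}(\pi)=m\}|=|\{\pi\in\mathfrak{S}_n(\omega'):\mathrm{des}(\pi)=m\}|$ for all $n\ge1$ and $m\ge0$. -}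

module Defs where

open import Data.Fin.Base using (Fin; toℕ; _<_)
open import Data.Fin.Patterns using (0F; 1F; 2F; 3F)
open import Data.Fin.Properties using (_≟_; _<?_; any?; all?)
open import Data.List.Base using (List; []; _∷_; allFin; cartesianProductWith; filter; length)
open import Data.Nat.Base using (ℕ; zero; suc; _≥_)
import Data.Nat.Properties as ℕ
open import Data.Product.Base using (∃-syntax; _×_; _,_; uncurry)
open import Data.Vec.Base using (Vec; []; _∷_; lookup)
open import Data.Vec.Relation.Unary.AllPairs using (allPairs?)
open import Data.Vec.Relation.Unary.Unique.Propositional using (Unique)
open import Function.Bundles using (_⇔_; mk⇔; Equivalence)
open import Relation.Binary.PropositionalEquality using (_≡_)
open import Relation.Nullary using (¬_; Dec)
open import Relation.Nullary.Decidable using (map′; ¬?; _×-dec_; _→-dec_)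
open import Relation.Unary using (Decidable)

-- One-line notation π₁ … πₙ.  Positions and values are indexed from 0, so
-- the entry πᵢ = v of the usual convention is stored as v - 1 at index i - 1.
Word : ℕ → Set
Word n = Vec (Fin n) n

-- By finiteness, a word of length n over n letters is a permutation exactly
-- when its letters are distinct.
IsPermutation : ∀ {n} → Word n → Set
IsPermutation π = Unique π

isPermutation? : ∀ {n} → Decidable (IsPermutation {n})
isPermutation? = allPairs? (λ x y → ¬? (x ≟ y))

-- All words of length k over the alphabet Fin n, each listed once.
words : ∀ n k → List (Vec (Fin n) k)
words n zero    = [] ∷ []
words n (suc k) = cartesianProductWith _∷_ (allFin n) (words n k)

𝔖 : ∀ n → List (Word n)
𝔖 n = filter isPermutation? (words n n)

IsNext : ∀ {n} → Fin n → Fin n → Set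
IsNext i i′ = toℕ i′ ≡ suc (toℕ i)

isNext? : ∀ {n} (i i′ : Fin n) → Dec (IsNext i i′)
isNext? i i′ = toℕ i′ ℕ.≟ suc (toℕ i)

Descent : ∀ {n} → Word n → Fin n → Set
Descent π i = ∃[ i′ ] IsNext i i′ × lookup π i′ < lookup π i

descent? : ∀ {n} (π : Word n) → Decidable (Descent π)
descent? π i = any? λ i′ → isNext? i i′ ×-dec lookup π i′ <? lookup π i

-- The last position is never a descent, since it has no successor.
des : ∀ {n} → Word n → ℕ
des {n} π = length (filter (descent? π) (allFin n))

OrderIsomorphic : ∀ {m n k} → Vec (Fin m) k → Vec (Fin n) k → Set
OrderIsomorphic u v = ∀ a b → lookup u a < lookup u b ⇔ lookup v a < lookup v b

orderIsomorphic? : ∀ {m n k} (u : Vec (Fin m) k) (v : Vec (Fin n) k) →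
                   Dec (OrderIsomorphic u v)
orderIsomorphic? u v = all? λ a → all? λ b →
  let P? = lookup u a <? lookup u b
      Q? = lookup v a <? lookup v b
  in map′ (uncurry mk⇔)
          (λ e → Equivalence.to e , Equivalence.from e)
          ((P? →-dec Q?) ×-dec (Q? →-dec P?))

-- Occurrences of the vincular pattern whose first three letters are
-- underlined: they must be matched in consecutive positions, the fourth letter
-- anywhere to their right.
OccursAt : ∀ {n} → Word 4 → Word n → Fin n → Fin n → Fin n → Fin n → Set
OccursAt ω π i i′ i″ j =
  IsNext i i′ × IsNext i′ i″ × i″ < j ×
  OrderIsomorphic (lookup π i ∷ lookup π i′ ∷ lookup π i″ ∷ lookup π j ∷ []) ω

Contains : ∀ {n} → Word 4 → Word n → Set
Contains ω π = ∃[ i ] ∃[ i′ ] ∃[ i″ ] ∃[ j ] OccursAt ω π i i′ i″ j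

contains? : ∀ {n} (ω : Word 4) → Decidable (Contains {n} ω)
contains? ω π = any? λ i → any? λ i′ → any? λ i″ → any? λ j →
  isNext? i i′ ×-dec isNext? i′ i″ ×-dec i″ <? j ×-dec
  orderIsomorphic? (lookup π i ∷ lookup π i′ ∷ lookup π i″ ∷ lookup π j ∷ []) ω

Avoids : ∀ {n} → Word 4 → Word n → Set
Avoids ω π = ¬ Contains ω π

avoids? : ∀ {n} (ω : Word 4) → Decidable (Avoids {n} ω)
avoids? ω π = ¬? (contains? ω π)

𝔖-avoiding : ∀ n → Word 4 → List (Word n)
𝔖-avoiding n ω = filter (avoids? ω) (𝔖 n)

#avoiders : ℕ → Word 4 → ℕ → ℕ
#avoiders n ω m = length (filter (λ π → des π ℕ.≟ m) (𝔖-avoiding n ω))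

infix 4 _∼des_

_∼des_ : Word 4 → Word 4 → Set
ω ∼des ω′ = ∀ n → n ≥ 1 → ∀ m → #avoiders n ω m ≡ #avoiders n ω′ m

-- The letters 1, 2, 3, 4 are 0F, 1F, 2F, 3F.
p1342 p1243 : Word 4
p1342 = 0F ∷ 2F ∷ 3F ∷ 1F ∷ []
p1243 = 0F ∷ 1F ∷ 3F ∷ 2F ∷ []

{-# OPTIONS --safe #-}
module Submission where

-- Permutations are built from right to left by putting a letter in front.  A
-- letter r in front of a permutation starting with b creates a descent, a tight
-- ascent or a loose ascent, according as r > b, r = b or r < b (before the old
-- letters ≥ r are raised by one).  Avoiding 1342 means that a loose ascent is
-- never put in front of an ascent; avoiding 1243 means that no ascent is put in
-- front of a loose one.  The joint distribution of the first letter, of the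
-- initial descent or ascent and of des is the same in both classes.  Indeed, by
-- induction, the claim reduces to an identity within the 1243-avoiders: over
-- permutations starting with an ascent, summing ψ(first letter) gives the same
-- as summing ψ(0) + … + ψ(first letter) over those starting with a tight ascent.
-- After removing the first letter, both become sums over the same permutations.

open import Defs

open import Data.Bool.Base using (Bool; true; false; T; if_then_else_; _∧_)
open import Data.Bool.Properties using (T?)
open import Data.Fin.Base as Fin using (Fin; zero; suc; toℕ; punchIn; punchOut)
open import Data.Fin.Patterns using (0F; 1F; 2F; 3F)
import Data.Fin.Properties as Fin
open import Data.List.Base as List
  using (List; []; _∷_; _++_; allFin; applyUpTo; cartesianProductWith; filter; length; tabulate)
import Data.List.Properties as List
open import Data.List.Relation.Unary.All as ListAll using ([]; _∷_)
open import Data.List.Relation.Unary.All.Properties using (all-filter)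
open import Data.Nat.Base using (ℕ; zero; suc; _+_; _∸_; _≤_; _<_; z≤n; s≤s; s≤s⁻¹)
open import Data.Nat.ListAction using (sum)
open import Data.Nat.ListAction.Properties using (sum-++)
import Data.Nat.Properties as ℕ
open import Algebra.Properties.CommutativeSemigroup ℕ.+-commutativeSemigroup using (interchange)
open import Data.Product.Base using (∃-syntax; _×_; _,_; proj₁; proj₂)
open import Data.Sum.Base as Sum using (_⊎_; inj₁; inj₂)
open import Data.Vec.Base as Vec using (Vec; []; _∷_; lookup)
open import Data.Vec.Properties using (lookup-map)
open import Data.Vec.Relation.Unary.All as All using (All; []; _∷_)
import Data.Vec.Relation.Unary.All.Properties as All
open import Data.Vec.Relation.Unary.AllPairs as AllPairs using (AllPairs; []; _∷_)
open import Data.Vec.Relation.Unary.Unique.Propositional using (Unique)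
import Data.Vec.Relation.Unary.Unique.Propositional.Properties as Unique
open import Function.Base using (_∘_; id)
open import Function.Bundles using (_⇔_; mk⇔; Equivalence)
open import Function.Construct.Symmetry using (⇔-sym)
open import Function.Construct.Composition using (_⇔-∘_)
open import Function.Related.TypeIsomorphisms using (¬-cong-⇔)
open import Relation.Binary.Definitions using (tri<; tri≈; tri>)
open import Relation.Binary.PropositionalEquality
  using (_≡_; _≢_; refl; sym; trans; cong; cong₂; subst; subst₂; _≗_; module ≡-Reasoning)
open import Relation.Nullary using (¬_; does; yes; no; contradiction)
open import Relation.Nullary.Decidable using (does-⇔; ¬?; _×-dec_; dec-true; dec-false)
open import Relation.Unary using (Decidable)

open ≡-Reasoning

private variable
  A B : Set
  k m n : ℕ

-- Sums over initial segments of the naturals.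

when : Bool → ℕ → ℕ
when b x = if b then x else 0

Σ< : ℕ → (ℕ → ℕ) → ℕ
Σ< n f = sum (applyUpTo f n)

Σ<-cong : ∀ n {f g} → f ≗ g → Σ< n f ≡ Σ< n g
Σ<-cong zero    f≗g = refl
Σ<-cong (suc n) f≗g = cong₂ _+_ (f≗g 0) (Σ<-cong n (f≗g ∘ suc))

Σ<-zero : ∀ n → Σ< n (λ _ → 0) ≡ 0
Σ<-zero zero    = refl
Σ<-zero (suc n) = Σ<-zero n

Σ<-+ : ∀ n f g → Σ< n (λ i → f i + g i) ≡ Σ< n f + Σ< n g
Σ<-+ zero    f g = refl
Σ<-+ (suc n) f g = trans (cong (f 0 + g 0 +_) (Σ<-+ n (f ∘ suc) (g ∘ suc)))
                         (interchange (f 0) (g 0) _ _)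

-- Weighted counting by successive insertion of first letters.

data Kind : Set where
  desc tight loose : Kind

compare : ℕ → ℕ → Kind
compare zero    zero    = tight
compare zero    (suc b) = loose
compare (suc r) zero    = desc
compare (suc r) (suc b) = compare r b

bump : Kind → ℕ → ℕ
bump desc  m = suc m
bump tight m = m
bump loose m = m

-- The first argument is the kind of the old word b c …, the second that of the
-- word obtained by putting r in front of it.  An occurrence of 1342 at the front
-- amounts to r < b < c, as the value r then occurs after c and plays the 2; one
-- of 1243 amounts to r ≤ b and b + 1 < c, with b + 1 playing the 3.
allowed1342 allowed1243 : Kind → Kind → Bool
allowed1342 desc  _     = true
allowed1342 tight loose = false
allowed1342 tight _     = true
allowed1342 loose loose = false
allowed1342 loose _     = true
allowed1243 loose desc  = true
allowed1243 loose _     = false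
allowed1243 _     _     = true

-- For b ≤ n, the letters r = 0, ..., n fall into three blocks according to their comparison with b,
-- so that each kind of insertion can be summed separately.
split : ℕ → ℕ → (ℕ → Kind → ℕ) → ℕ
split n b g = Σ< b (λ r → g r loose) + (g b tight + Σ< (n ∸ b) (λ i → g (suc b + i) desc))

split-cong : ∀ n b {f g : ℕ → Kind → ℕ} → (∀ r κ → f r κ ≡ g r κ) → split n b f ≡ split n b g
split-cong n b f≗g = cong₂ _+_ (Σ<-cong b λ r → f≗g r loose)
  (cong₂ _+_ (f≗g b tight) (Σ<-cong (n ∸ b) λ i → f≗g (suc b + i) desc))

split-+ : ∀ n b f g → split n b (λ r κ → f r κ + g r κ) ≡ split n b f + split n b g
split-+ n b f g = begin
  split n b (λ r κ → f r κ + g r κ)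
    ≡⟨ cong₂ (λ x y → x + (f b tight + g b tight + y)) (Σ<-+ b _ _) (Σ<-+ (n ∸ b) _ _) ⟩
  (lf + lg) + ((f b tight + g b tight) + (df + dg))
    ≡⟨ cong (lf + lg +_) (interchange (f b tight) (g b tight) df dg) ⟩
  (lf + lg) + ((f b tight + df) + (g b tight + dg))
    ≡⟨ interchange lf lg _ _ ⟩
  split n b f + split n b g ∎
  where
  lf = Σ< b (λ r → f r loose)
  lg = Σ< b (λ r → g r loose)
  df = Σ< (n ∸ b) (λ i → f (suc b + i) desc)
  dg = Σ< (n ∸ b) (λ i → g (suc b + i) desc)

-- The arguments stand for the first letter, the kind and the descent number of a permutation.
Weight : Set
Weight = ℕ → Kind → ℕ → ℕ

infix 4 _≐_
_≐_ : Weight → Weight → Set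
φ ≐ ψ = ∀ b κ m → φ b κ m ≡ ψ b κ m

infixl 6 _⊞_
_⊞_ : Weight → Weight → Weight
(φ ⊞ ψ) b κ m = φ b κ m + ψ b κ m

restrict : (Kind → Kind → Bool) → Weight → Kind → ℕ → ℕ → Kind → ℕ
restrict allowed φ κ m r κ′ = when (allowed κ κ′) (φ r κ′ (bump κ′ m))

-- The new weight of a permutation of length n collects the weights φ of its allowed extensions, so
-- the last insertion is absorbed into the weight.
extend : (Kind → Kind → Bool) → ℕ → Weight → Weight
extend allowed n φ b κ m = split n b (restrict allowed φ κ m)

-- The φ-weight, in length n + 1, of the class generated by `allowed` from the one-letter word,
-- which has first letter 0, kind `desc` and no descents.
total : (Kind → Kind → Bool) → ℕ → Weight → ℕ
total allowed zero    φ = φ 0 desc 0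
total allowed (suc n) φ = total allowed n (extend allowed (suc n) φ)

when-+ : ∀ b x y → when b (x + y) ≡ when b x + when b y
when-+ true  x y = refl
when-+ false x y = refl

total-cong : ∀ al n {φ ψ} → φ ≐ ψ → total al n φ ≡ total al n ψ
total-cong al zero    φ≐ψ = φ≐ψ 0 desc 0
total-cong al (suc n) φ≐ψ = total-cong al n λ b κ m → split-cong (suc n) b λ r κ′ →
  cong (when (al κ κ′)) (φ≐ψ r κ′ (bump κ′ m))

total-+ : ∀ al n φ ψ → total al n (φ ⊞ ψ) ≡ total al n φ + total al n ψ
total-+ al zero    φ ψ = refl
total-+ al (suc n) φ ψ = trans
  (total-cong al n λ b κ m → trans
    (split-cong (suc n) b λ r κ′ → when-+ (al κ κ′) (φ r κ′ (bump κ′ m)) (ψ r κ′ (bump κ′ m)))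
    (split-+ (suc n) b (restrict al φ κ m) (restrict al ψ κ m)))
  (total-+ al n _ _)

-- Comparison of the two weighted totals.

ascending : (ℕ → ℕ → ℕ) → Weight
ascending ψ b desc  m = 0
ascending ψ b tight m = ψ b m
ascending ψ b loose m = ψ b m

cumulativeTight : (ℕ → ℕ → ℕ) → Weight
cumulativeTight ψ b desc  m = 0
cumulativeTight ψ b tight m = Σ< b (λ r → ψ r m) + ψ b m
cumulativeTight ψ b loose m = 0

-- If a tight ascent can be put in front of a permutation starting with b, so can
-- every r ≤ b, and these are its extensions by ascents.
total-ascending : ∀ n ψ →
  total allowed1243 n (ascending ψ) ≡ total allowed1243 n (cumulativeTight ψ)
total-ascending zero    ψ = refl
total-ascending (suc n) ψ = total-cong allowed1243 n λ where
    b desc  m → regroup b m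
    b tight m → regroup b m
    b loose m → refl
  where
  regroup : ∀ b m → let Z = Σ< (suc n ∸ b) (λ _ → 0) in
            Σ< b (λ r → ψ r m) + (ψ b m + Z) ≡
            Σ< b (λ _ → 0) + ((Σ< b (λ r → ψ r m) + ψ b m) + Z)
  regroup b m rewrite Σ<-zero b = sym (ℕ.+-assoc (Σ< b (λ r → ψ r m)) (ψ b m) _)

-- The split of ascents into tight and loose is not equidistributed: in length 4 the excluded
-- permutation 1342 starts with a loose ascent, 1243 with a tight one. Weights must therefore ignore
-- it.
Coarse : Weight → Set
Coarse φ = ∀ b m → φ b loose m ≡ φ b tight m

total-1342≡1243 : ∀ n φ → Coarse φ → total allowed1342 n φ ≡ total allowed1243 n φ
total-1342≡1243 zero    φ coarse = refl
total-1342≡1243 (suc n) φ coarse = begin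
  total allowed1342 n (extend allowed1342 (suc n) φ)
    -- The extended weight is coarse again, because `allowed1342` treats `tight` and `loose` alike
    -- in its first argument.
    ≡⟨ total-1342≡1243 n _ (λ _ _ → refl) ⟩
  total allowed1243 n (extend allowed1342 (suc n) φ)
    ≡⟨ total-cong allowed1243 n extend-1342 ⟩
  total allowed1243 n (common ⊞ ascending ψ)
    ≡⟨ total-+ allowed1243 n common (ascending ψ) ⟩
  total allowed1243 n common + total allowed1243 n (ascending ψ)
    ≡⟨ cong (total allowed1243 n common +_) (total-ascending n ψ) ⟩
  total allowed1243 n common + total allowed1243 n (cumulativeTight ψ)
    ≡⟨ total-+ allowed1243 n common (cumulativeTight ψ) ⟨
  total allowed1243 n (common ⊞ cumulativeTight ψ)
    ≡⟨ total-cong allowed1243 n extend-1243 ⟨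
  total allowed1243 n (extend allowed1243 (suc n) φ) ∎
  where
  ψ : ℕ → ℕ → ℕ
  ψ b m = φ b tight m

  descents : ℕ → ℕ → ℕ
  descents b m = Σ< (suc n ∸ b) (λ i → φ (suc b + i) desc (suc m))

  -- After a descent both classes allow every letter; after an ascent both allow a descent. Beyond
  -- this, 1342 allows the tight insertion after either kind of ascent, and 1243 allows every
  -- ascent, but only after a tight one.
  common : Weight
  common b desc  m = Σ< b (λ r → φ r loose m) + (φ b tight m + descents b m)
  common b tight m = descents b m
  common b loose m = descents b m

  shift : ∀ b m → Σ< b (λ _ → 0) + (φ b tight m + descents b m) ≡ descents b m + ψ b m
  shift b m rewrite Σ<-zero b = ℕ.+-comm (φ b tight m) (descents b m)

  extend-1342 : extend allowed1342 (suc n) φ ≐ common ⊞ ascending ψ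
  extend-1342 b desc  m = sym (ℕ.+-identityʳ _)
  extend-1342 b tight m = shift b m
  extend-1342 b loose m = shift b m

  extend-1243 : extend allowed1243 (suc n) φ ≐ common ⊞ cumulativeTight ψ
  extend-1243 b desc  m = sym (ℕ.+-identityʳ _)
  extend-1243 b tight m = begin
    Σ< b (λ r → φ r loose m) + (φ b tight m + descents b m)
      ≡⟨ ℕ.+-assoc (Σ< b (λ r → φ r loose m)) (φ b tight m) (descents b m) ⟨
    Σ< b (λ r → φ r loose m) + φ b tight m + descents b m
      -- Coarseness lets `ψ`, taken from tight ascents, also weigh the loose insertions r < b.
      ≡⟨ cong (λ x → x + φ b tight m + descents b m) (Σ<-cong b λ r → coarse r m) ⟩
    Σ< b (λ r → ψ r m) + ψ b m + descents b m
      ≡⟨ ℕ.+-comm _ (descents b m) ⟩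
    descents b m + (Σ< b (λ r → ψ r m) + ψ b m) ∎
  extend-1243 b loose m rewrite Σ<-zero b = sym (ℕ.+-identityʳ _)

-- Sums over `Fin` and over lists.

sum-tabulate : ∀ n f → sum (tabulate {n = n} (f ∘ toℕ)) ≡ Σ< n f
sum-tabulate zero    f = refl
sum-tabulate (suc n) f = cong (f 0 +_) (sum-tabulate n (f ∘ suc))

sum-compare : ∀ n {b} → b ≤ n → ∀ (g : ℕ → Kind → ℕ) →
  sum (tabulate {n = suc n} (λ r → g (toℕ r) (compare (toℕ r) b))) ≡ split n b g
sum-compare n       z≤n       g = cong (g 0 tight +_) (sum-tabulate n λ i → g (suc i) desc)
sum-compare (suc n) (s≤s b≤n) g =
  trans (cong (g 0 loose +_) (sum-compare n b≤n (g ∘ suc)))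
        (sym (ℕ.+-assoc (g 0 loose) _ _))

opaque
  ∑ : List A → (A → ℕ) → ℕ
  ∑ xs f = sum (List.map f xs)

  ∑-singleton : ∀ (f : A → ℕ) x → ∑ (x ∷ []) f ≡ f x
  ∑-singleton f x = ℕ.+-identityʳ (f x)

  ∑-cong : ∀ {f g : A → ℕ} → f ≗ g → ∀ xs → ∑ xs f ≡ ∑ xs g
  ∑-cong f≗g xs = cong sum (List.map-cong f≗g xs)

  ∑-cong-All : ∀ {f g : A → ℕ} {xs} → ListAll.All (λ x → f x ≡ g x) xs → ∑ xs f ≡ ∑ xs g
  ∑-cong-All []         = refl
  ∑-cong-All (eq ∷ eqs) = cong₂ _+_ eq (∑-cong-All eqs)

  ∑-map : ∀ (h : A → B) f xs → ∑ (List.map h xs) f ≡ ∑ xs (f ∘ h)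
  ∑-map h f xs = cong sum (sym (List.map-∘ xs))

  ∑-filter : ∀ {P : A → Set} (P? : Decidable P) f xs →
             ∑ (filter P? xs) f ≡ ∑ xs (λ x → when (does (P? x)) (f x))
  ∑-filter P? f [] = refl
  ∑-filter P? f (x ∷ xs) with does (P? x)
  ... | true  = cong (f x +_) (∑-filter P? f xs)
  ... | false = ∑-filter P? f xs

  length-filter : ∀ {P : A → Set} (P? : Decidable P) xs →
                  length (filter P? xs) ≡ ∑ xs (λ x → when (does (P? x)) 1)
  length-filter P? [] = refl
  length-filter P? (x ∷ xs) with does (P? x)
  ... | true  = cong suc (length-filter P? xs)
  ... | false = length-filter P? xs

  ∑-zero : ∀ (xs : List A) → ∑ xs (λ _ → 0) ≡ 0
  ∑-zero []       = refl
  ∑-zero (x ∷ xs) = ∑-zero xs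

  ∑-+ : ∀ (f g : A → ℕ) xs → ∑ xs (λ x → f x + g x) ≡ ∑ xs f + ∑ xs g
  ∑-+ f g []       = refl
  ∑-+ f g (x ∷ xs) = trans (cong (f x + g x +_) (∑-+ f g xs)) (interchange (f x) (g x) _ _)

  ∑-swap : ∀ (xs : List A) (ys : List B) (f : A → B → ℕ) →
           ∑ xs (λ x → ∑ ys (f x)) ≡ ∑ ys (λ y → ∑ xs (λ x → f x y))
  ∑-swap []       ys f = sym (∑-zero ys)
  ∑-swap (x ∷ xs) ys f = trans (cong (∑ ys (f x) +_) (∑-swap xs ys f))
                               (sym (∑-+ (f x) (λ y → ∑ xs (λ z → f z y)) ys))

  ∑-++ : ∀ f (xs ys : List A) → ∑ (xs ++ ys) f ≡ ∑ xs f + ∑ ys f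
  ∑-++ f xs ys = trans (cong sum (List.map-++ f xs ys)) (sum-++ (List.map f xs) (List.map f ys))

  ∑-cartesianProductWith : ∀ {C : Set} (h : A → B → C) f xs ys →
    ∑ (cartesianProductWith h xs ys) f ≡ ∑ xs (λ x → ∑ ys (λ y → f (h x y)))
  ∑-cartesianProductWith h f []       ys = refl
  ∑-cartesianProductWith h f (x ∷ xs) ys = trans
    (∑-++ f (List.map (h x) ys) (cartesianProductWith h xs ys))
    (cong₂ _+_ (∑-map (h x) f ys) (∑-cartesianProductWith h f xs ys))

  ∑-allFin : ∀ n (f : Fin n → ℕ) → ∑ (allFin n) f ≡ sum (tabulate f)
  ∑-allFin n f = cong sum (List.map-tabulate id f)

  when-∑ : ∀ b (f : A → ℕ) xs → when b (∑ xs f) ≡ ∑ xs (when b ∘ f)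
  when-∑ true  f xs = refl
  when-∑ false f xs = sym (∑-zero xs)

when-∧ : ∀ a b {x} → when (a ∧ b) x ≡ when a (when b x)
when-∧ true  b = refl
when-∧ false b = refl

-- Decomposition of a permutation by its first letter.

infixr 5 _⊕_
_⊕_ : Fin (suc k) → Vec (Fin k) n → Vec (Fin (suc k)) (suc n)
r ⊕ w = r ∷ Vec.map (punchIn r) w

distinct? : Decidable (Unique {A = Fin k} {n})
distinct? = AllPairs.allPairs? (λ x y → ¬? (x Fin.≟ y))

fresh? : ∀ (r : Fin k) → Decidable (All (r ≢_) {n})
fresh? r = All.all? (λ x → ¬? (r Fin.≟ x))

sum-punchIn : ∀ (r : Fin (suc n)) f →
  sum (tabulate (λ x → when (does (¬? (r Fin.≟ x))) (f x))) ≡ sum (tabulate (f ∘ punchIn r))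
sum-punchIn zero f = refl
sum-punchIn {suc n} (suc r) f = cong (f zero +_) (sum-punchIn r (f ∘ suc))

∑-punchIn : ∀ (r : Fin (suc n)) f →
  ∑ (allFin (suc n)) (λ x → when (does (¬? (r Fin.≟ x))) (f x)) ≡ ∑ (allFin n) (f ∘ punchIn r)
∑-punchIn r f = begin
  ∑ (allFin _) (λ x → when (does (¬? (r Fin.≟ x))) (f x))      ≡⟨ ∑-allFin _ _ ⟩
  sum (tabulate (λ x → when (does (¬? (r Fin.≟ x))) (f x)))    ≡⟨ sum-punchIn r f ⟩
  sum (tabulate (f ∘ punchIn r))                               ≡⟨ ∑-allFin _ _ ⟨
  ∑ (allFin _) (f ∘ punchIn r)                                 ∎

-- `punchIn r` identifies the smaller alphabet with the letters other than r; applied letter by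
-- letter, it yields exactly the words free of r.
∑-fresh : ∀ (r : Fin (suc n)) k f →
  ∑ (words (suc n) k) (λ v → when (does (fresh? r v)) (f v)) ≡
  ∑ (words n k) (f ∘ Vec.map (punchIn r))
∑-fresh r zero f = trans (∑-singleton _ []) (sym (∑-singleton _ []))
∑-fresh {n} r (suc k) f = begin
  ∑ (words (suc n) (suc k)) (λ v → when (does (fresh? r v)) (f v))
    ≡⟨ ∑-cartesianProductWith _∷_ _ (allFin (suc n)) (words (suc n) k) ⟩
  ∑ (allFin (suc n)) (λ x → ∑ (words (suc n) k) λ v →
    when (x≢ x ∧ does (fresh? r v)) (f (x ∷ v)))
    ≡⟨ ∑-cong (λ x → trans (∑-cong (λ v → when-∧ (x≢ x) _) (words (suc n) k))
                           (sym (when-∑ (x≢ x) _ (words (suc n) k)))) (allFin (suc n)) ⟩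
  ∑ (allFin (suc n)) (λ x →
    when (x≢ x) (∑ (words (suc n) k) λ v → when (does (fresh? r v)) (f (x ∷ v))))
    ≡⟨ ∑-punchIn r _ ⟩
  ∑ (allFin n) (λ y → ∑ (words (suc n) k) λ v → when (does (fresh? r v)) (f (punchIn r y ∷ v)))
    ≡⟨ ∑-cong (λ y → ∑-fresh r k (f ∘ (punchIn r y ∷_))) (allFin n) ⟩
  ∑ (allFin n) (λ y → ∑ (words n k) λ w → f (punchIn r y ∷ Vec.map (punchIn r) w))
    ≡⟨ ∑-cartesianProductWith _∷_ _ (allFin n) (words n k) ⟨
  ∑ (words n (suc k)) (f ∘ Vec.map (punchIn r)) ∎
  where
  x≢ : Fin (suc n) → Bool
  x≢ x = does (¬? (r Fin.≟ x))

unique-map-punchIn : ∀ (r : Fin (suc k)) {w : Vec (Fin k) n} →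
                     Unique (Vec.map (punchIn r) w) ⇔ Unique w
unique-map-punchIn r = mk⇔ unmap (Unique.map⁺ (Fin.punchIn-injective r _ _))
  where
  unmap : ∀ {n} {w : Vec _ n} → Unique (Vec.map (punchIn r) w) → Unique w
  unmap {w = []}    []       = []
  unmap {w = x ∷ w} (p ∷ ps) = All.map (_∘ cong (punchIn r)) (All.map⁻ p) ∷ unmap ps

-- Every permutation is `r ⊕ w` for exactly one r and one w: its tail omits its first letter r, so
-- the tail is an image under `punchIn r`, and injectivity of this map carries distinctness over to
-- w.
∑-𝔖 : ∀ n f → ∑ (𝔖 (suc n)) f ≡ ∑ (𝔖 n) (λ w → ∑ (allFin (suc n)) λ r → f (r ⊕ w))
∑-𝔖 n f = begin
  ∑ (𝔖 (suc n)) f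
    ≡⟨ ∑-filter isPermutation? f (words (suc n) (suc n)) ⟩
  ∑ (words (suc n) (suc n)) (λ v → when (does (distinct? v)) (f v))
    ≡⟨ ∑-cartesianProductWith _∷_ _ (allFin (suc n)) (words (suc n) n) ⟩
  ∑ (allFin (suc n)) (λ r → ∑ (words (suc n) n) λ v →
    when (does (fresh? r v) ∧ does (distinct? v)) (f (r ∷ v)))
    ≡⟨ ∑-cong (λ r → trans (∑-cong (λ v → when-∧ (does (fresh? r v)) _) (words (suc n) n))
                           (∑-fresh r n _)) (allFin (suc n)) ⟩
  ∑ (allFin (suc n)) (λ r → ∑ (words n n) λ w →
    when (does (distinct? (Vec.map (punchIn r) w))) (f (r ⊕ w)))
    ≡⟨ ∑-cong (λ r → ∑-cong (λ w → cong (λ b → when b (f (r ⊕ w)))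
         (does-⇔ (unique-map-punchIn r) (distinct? _) (distinct? w))) (words n n)) (allFin (suc n)) ⟩
  ∑ (allFin (suc n)) (λ r → ∑ (words n n) λ w → when (does (distinct? w)) (f (r ⊕ w)))
    ≡⟨ ∑-cong (λ r → ∑-filter isPermutation? (f ∘ (r ⊕_)) (words n n)) (allFin (suc n)) ⟨
  ∑ (allFin (suc n)) (λ r → ∑ (𝔖 n) λ w → f (r ⊕ w))
    ≡⟨ ∑-swap (allFin (suc n)) (𝔖 n) (λ r w → f (r ⊕ w)) ⟩
  ∑ (𝔖 n) (λ w → ∑ (allFin (suc n)) λ r → f (r ⊕ w)) ∎

-- Order relations under `punchIn`.

data Comparison (r b : ℕ) : Kind → Set where
  desc  : b < r → Comparison r b desc
  tight : r ≡ b → Comparison r b tight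
  loose : r < b → Comparison r b loose

comparison : ∀ r b → Comparison r b (compare r b)
comparison zero    zero    = tight refl
comparison zero    (suc b) = loose (s≤s z≤n)
comparison (suc r) zero    = desc (s≤s z≤n)
comparison (suc r) (suc b) with compare r b | comparison r b
... | _ | desc  b<r = desc (s≤s b<r)
... | _ | tight r≡b = tight (cong suc r≡b)
... | _ | loose r<b = loose (s≤s r<b)

-- `kind` compares r + 1 with the second letter of the new word, which is b raised exactly when r ≤
-- b; the outcome is that of comparing r with the old letter b.
compare-punchIn : ∀ (r : Fin (suc n)) b →
  compare (suc (toℕ r)) (toℕ (punchIn r b)) ≡ compare (toℕ r) (toℕ b)
compare-punchIn zero    b       = refl
compare-punchIn (suc r) zero    = refl
compare-punchIn (suc r) (suc b) = compare-punchIn r b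

r<punchIn⇔r≤ : ∀ (r : Fin (suc n)) b → r Fin.< punchIn r b ⇔ r Fin.≤ b
r<punchIn⇔r≤ r b = mk⇔ (to r b) (from r b)
  where
  to : ∀ {n} (r : Fin (suc n)) b → r Fin.< punchIn r b → r Fin.≤ b
  to zero    b       _         = z≤n
  to (suc r) (suc b) (s≤s r<p) = s≤s (to r b r<p)

  from : ∀ {n} (r : Fin (suc n)) b → r Fin.≤ b → r Fin.< punchIn r b
  from zero    b       _         = s≤s z≤n
  from (suc r) (suc b) (s≤s r≤b) = s≤s (from r b r≤b)

punchIn<r⇔<r : ∀ (r : Fin (suc n)) b → punchIn r b Fin.< r ⇔ b Fin.< r
punchIn<r⇔<r r b = mk⇔ (to r b) (from r b)
  where
  to : ∀ {n} (r : Fin (suc n)) b → punchIn r b Fin.< r → b Fin.< r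
  to (suc r) zero    _         = s≤s z≤n
  to (suc r) (suc b) (s≤s p<r) = s≤s (to r b p<r)

  from : ∀ {n} (r : Fin (suc n)) b → b Fin.< r → punchIn r b Fin.< r
  from (suc r) zero    _         = s≤s z≤n
  from (suc r) (suc b) (s≤s b<r) = s≤s (from r b b<r)

punchIn-< : ∀ (r : Fin (suc n)) x y → punchIn r x Fin.< punchIn r y ⇔ x Fin.< y
punchIn-< r x y = mk⇔
  (λ p<q → ℕ.≰⇒> (ℕ.<⇒≱ p<q ∘ Fin.punchIn-mono-≤ r y x))
  (λ x<y → ℕ.≰⇒> (ℕ.<⇒≱ x<y ∘ Fin.punchIn-cancel-≤ r y x))

-- One-letter words are grouped with the descents: both can be preceded by any
-- letter.
kind : Vec (Fin k) (suc n) → Kind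
kind (x ∷ [])    = desc
kind (x ∷ y ∷ _) = compare (suc (toℕ x)) (toℕ y)

weigh : Weight → Word (suc n) → ℕ
weigh φ w = φ (toℕ (Vec.head w)) (kind w) (des w)

-- The descent number after an insertion.

des-sum : ∀ (π : Word n) → des π ≡ sum (tabulate (λ i → when (does (descent? π i)) 1))
des-sum {n} π = trans (length-filter (descent? π) (allFin n)) (∑-allFin n _)

descent-⊕-suc : ∀ (r : Fin (suc n)) (w : Word n) i → Descent (r ⊕ w) (suc i) ⇔ Descent w i
descent-⊕-suc r w i = mk⇔ to from
  where
  to : Descent (r ⊕ w) (suc i) → Descent w i
  to (suc j , next , lt) = j , ℕ.suc-injective next ,
    Equivalence.to (punchIn-< r _ _)
      (subst₂ Fin._<_ (lookup-map j (punchIn r) w) (lookup-map i (punchIn r) w) lt)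

  from : Descent w i → Descent (r ⊕ w) (suc i)
  from (j , next , lt) = suc j , cong suc next ,
    subst₂ Fin._<_ (sym (lookup-map j (punchIn r) w)) (sym (lookup-map i (punchIn r) w))
      (Equivalence.from (punchIn-< r _ _) lt)

descent-⊕-zero : ∀ (r : Fin (suc (suc n))) b (w : Vec _ n) →
                 Descent (r ⊕ (b ∷ w)) zero ⇔ b Fin.< r
descent-⊕-zero r b w = mk⇔ to from
  where
  to : Descent (r ⊕ (b ∷ w)) zero → b Fin.< r
  to (suc zero , _ , lt) = Equivalence.to (punchIn<r⇔<r r b) lt

  from : b Fin.< r → Descent (r ⊕ (b ∷ w)) zero
  from b<r = suc zero , refl , Equivalence.from (punchIn<r⇔<r r b) b<r

-- `punchIn r` preserves order, so the old descents persist and only the first position can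
-- contribute a new one.
des-⊕ : ∀ (r : Fin (suc (suc n))) (w : Word (suc n)) →
        des (r ⊕ w) ≡ bump (compare (toℕ r) (toℕ (Vec.head w))) (des w)
des-⊕ {n} r (b ∷ w) = begin
  des (r ⊕ (b ∷ w))
    ≡⟨ des-sum (r ⊕ (b ∷ w)) ⟩
  first + sum (tabulate (λ i → when (does (descent? (r ⊕ (b ∷ w)) (suc i))) 1))
    ≡⟨ cong (λ xs → first + sum xs) (List.tabulate-cong λ i → cong (λ t → when t 1)
         (does-⇔ (descent-⊕-suc r (b ∷ w) i)
           (descent? (r ⊕ (b ∷ w)) (suc i)) (descent? (b ∷ w) i))) ⟩
  first + sum (tabulate (λ i → when (does (descent? (b ∷ w) i)) 1))
    ≡⟨ cong (first +_) (des-sum (b ∷ w)) ⟨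
  first + des (b ∷ w)
    ≡⟨ first-step ⟩
  bump (compare (toℕ r) (toℕ b)) (des (b ∷ w)) ∎
  where
  first : ℕ
  first = when (does (descent? (r ⊕ (b ∷ w)) zero)) 1

  no-descent : ¬ b Fin.< r → first + des (b ∷ w) ≡ des (b ∷ w)
  no-descent b≮r = cong (λ t → when t 1 + des (b ∷ w))
    (dec-false (descent? (r ⊕ (b ∷ w)) zero) (b≮r ∘ Equivalence.to (descent-⊕-zero r b w)))

  first-step : first + des (b ∷ w) ≡ bump (compare (toℕ r) (toℕ b)) (des (b ∷ w))
  first-step with compare (toℕ r) (toℕ b) | comparison (toℕ r) (toℕ b)
  ... | _ | desc b<r  = cong (λ t → when t 1 + des (b ∷ w))
    (dec-true (descent? (r ⊕ (b ∷ w)) zero) (Equivalence.from (descent-⊕-zero r b w) b<r))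
  ... | _ | tight r≡b = no-descent (ℕ.<-irrefl (sym r≡b))
  ... | _ | loose r<b = no-descent (ℕ.<-asym r<b)

weigh-⊕ : ∀ φ (r : Fin (suc (suc n))) (w : Word (suc n)) →
  let κ = compare (toℕ r) (toℕ (Vec.head w)) in weigh φ (r ⊕ w) ≡ φ (toℕ r) κ (bump κ (des w))
weigh-⊕ φ r (b ∷ w) = cong₂ (φ (toℕ r)) (compare-punchIn r b) (des-⊕ r (b ∷ w))

-- Generation of the avoiders.

-- Whether a new first letter preserves avoidance is decided by two kinds. Distinctness enters
-- because the argument relies on every value occurring in w.
Insertion : Word 4 → (Kind → Kind → Bool) → Set
Insertion ω allowed = ∀ n (r : Fin (suc (suc n))) (w : Word (suc n)) → Unique w →
  Avoids ω (r ⊕ w) ⇔ (Avoids ω w × T (allowed (kind w) (compare (toℕ r) (toℕ (Vec.head w)))))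

avoids-short : n ≤ 2 → ∀ ω (π : Word n) → Avoids ω π
avoids-short n≤2 ω π (i , i′ , i″ , j , next , next′ , _) =
  ℕ.<⇒≱ (ℕ.<-≤-trans (Fin.toℕ<n i″) n≤2)
        (subst (2 ≤_) (sym (trans next′ (cong suc next))) (s≤s (s≤s z≤n)))

-- Removing the first letter turns the weight φ on length n + 2 into its extension on length n + 1,
-- so the induction runs over all weights at once.
∑-avoiding : ∀ ω al → Insertion ω al → ∀ n φ →
             ∑ (𝔖-avoiding (suc n) ω) (weigh φ) ≡ total al n φ
∑-avoiding ω al insertion zero φ = trans
  (∑-filter (avoids? ω) (weigh φ) (𝔖 1))
  (trans (∑-singleton _ (zero ∷ []))
         (cong (λ t → when t (weigh φ (zero ∷ [])))
           (dec-true (avoids? ω (zero ∷ [])) (avoids-short (s≤s z≤n) ω (zero ∷ [])))))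
∑-avoiding ω al insertion (suc n) φ = begin
  ∑ (𝔖-avoiding (suc (suc n)) ω) (weigh φ)
    ≡⟨ ∑-filter (avoids? ω) (weigh φ) (𝔖 (suc (suc n))) ⟩
  ∑ (𝔖 (suc (suc n))) (λ v → when (does (avoids? ω v)) (weigh φ v))
    ≡⟨ ∑-𝔖 (suc n) _ ⟩
  ∑ (𝔖 (suc n)) (λ w → ∑ (allFin (suc (suc n))) λ r →
    when (does (avoids? ω (r ⊕ w))) (weigh φ (r ⊕ w)))
    -- The insertion law concerns words with distinct letters, so the summands are compared only on
    -- members of `𝔖`.
    ≡⟨ ∑-cong-All (ListAll.map (λ {w} → fibre w) (all-filter isPermutation? (words (suc n) (suc n)))) ⟩
  ∑ (𝔖 (suc n)) (λ w → when (does (avoids? ω w)) (weigh (extend al (suc n) φ) w))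
    ≡⟨ ∑-filter (avoids? ω) _ (𝔖 (suc n)) ⟨
  ∑ (𝔖-avoiding (suc n) ω) (weigh (extend al (suc n) φ))
    ≡⟨ ∑-avoiding ω al insertion n (extend al (suc n) φ) ⟩
  total al (suc n) φ ∎
  where
  fibre : ∀ w → Unique w →
    ∑ (allFin (suc (suc n))) (λ r → when (does (avoids? ω (r ⊕ w))) (weigh φ (r ⊕ w))) ≡
    when (does (avoids? ω w)) (weigh (extend al (suc n) φ) w)
  fibre w uniq = begin
    ∑ (allFin (suc (suc n))) (λ r → when (does (avoids? ω (r ⊕ w))) (weigh φ (r ⊕ w)))
      ≡⟨ ∑-cong (λ r → trans
           (cong₂ when
             (does-⇔ (insertion n r w uniq) (avoids? ω (r ⊕ w))
               (avoids? ω w ×-dec T? (al (kind w) (compare (toℕ r) (toℕ (Vec.head w))))))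
             (weigh-⊕ φ r w))
           (when-∧ (does (avoids? ω w)) _)) (allFin (suc (suc n))) ⟩
    ∑ (allFin (suc (suc n))) (λ r → when (does (avoids? ω w))
      (g (toℕ r) (compare (toℕ r) (toℕ (Vec.head w)))))
      ≡⟨ when-∑ (does (avoids? ω w)) _ (allFin (suc (suc n))) ⟨
    when (does (avoids? ω w))
      (∑ (allFin (suc (suc n))) λ r → g (toℕ r) (compare (toℕ r) (toℕ (Vec.head w))))
      ≡⟨ cong (when (does (avoids? ω w))) (trans (∑-allFin (suc (suc n)) _)
           (sum-compare (suc n) (ℕ.<⇒≤ (Fin.toℕ<n (Vec.head w))) g)) ⟩
    when (does (avoids? ω w)) (weigh (extend al (suc n) φ) w) ∎
    where
    g : ℕ → Kind → ℕ
    g = restrict al φ (kind w) (des w)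

-- Order isomorphism with the two patterns.

lookup-mono-< : {s : Vec (Fin n) k} → AllPairs Fin._<_ s →
                ∀ {i j} → i Fin.< j → lookup s i Fin.< lookup s j
lookup-mono-< (ps ∷ _)  {zero}  {suc j} _         = All.lookup⁺ ps j
lookup-mono-< (_ ∷ pss) {suc i} {suc j} (s≤s i<j) = lookup-mono-< pss i<j

lookup-cancel-< : {s : Vec (Fin n) k} → AllPairs Fin._<_ s →
                  ∀ {i j} → lookup s i Fin.< lookup s j → i Fin.< j
lookup-cancel-< {s = s} inc {i} {j} lt with Fin.<-cmp i j
... | tri< i<j _ _ = i<j
... | tri≈ _ refl _ = contradiction lt (ℕ.<-irrefl refl)
... | tri> _ _ j<i = contradiction lt (ℕ.<-asym (lookup-mono-< inc j<i))

increasing : ∀ {x y z u : Fin n} → x Fin.< y → y Fin.< z → z Fin.< u →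
             AllPairs Fin._<_ (x ∷ y ∷ z ∷ u ∷ [])
increasing x<y y<z z<u =
  (x<y ∷ ℕ.<-trans x<y y<z ∷ ℕ.<-trans (ℕ.<-trans x<y y<z) z<u ∷ []) ∷
  (y<z ∷ ℕ.<-trans y<z z<u ∷ []) ∷ (z<u ∷ []) ∷ [] ∷ []

-- As s is increasing, indexing into it preserves and reflects order, and u is the image of ω under
-- this indexing.
orderIsomorphic-rearrangement : ∀ {s : Vec (Fin m) n} (u : Vec (Fin m) k) (ω : Vec (Fin n) k) →
  AllPairs Fin._<_ s → (∀ a → lookup u a ≡ lookup s (lookup ω a)) → OrderIsomorphic u ω
orderIsomorphic-rearrangement u ω inc eq a b = mk⇔
  (λ lt → lookup-cancel-< inc (subst₂ Fin._<_ (eq a) (eq b) lt))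
  (λ lt → subst₂ Fin._<_ (sym (eq a)) (sym (eq b)) (lookup-mono-< inc lt))

-- The chain lists the letters by increasing pattern value; it determines all other comparisons, and
-- `p1342` records the rank of each letter.
orderIsomorphic-1342 : ∀ {x y z u : Fin n} →
  OrderIsomorphic (x ∷ y ∷ z ∷ u ∷ []) p1342 ⇔ (x Fin.< u × u Fin.< y × y Fin.< z)
orderIsomorphic-1342 {x = x} {y} {z} {u} = mk⇔
  (λ iso → Equivalence.from (iso 0F 3F) (s≤s z≤n) ,
           Equivalence.from (iso 3F 1F) (s≤s (s≤s z≤n)) ,
           Equivalence.from (iso 1F 2F) (s≤s (s≤s (s≤s z≤n))))
  (λ (x<u , u<y , y<z) → orderIsomorphic-rearrangement (x ∷ y ∷ z ∷ u ∷ []) p1342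
    (increasing x<u u<y y<z) λ { 0F → refl ; 1F → refl ; 2F → refl ; 3F → refl })

orderIsomorphic-1243 : ∀ {x y z u : Fin n} →
  OrderIsomorphic (x ∷ y ∷ z ∷ u ∷ []) p1243 ⇔ (x Fin.< y × y Fin.< u × u Fin.< z)
orderIsomorphic-1243 {x = x} {y} {z} {u} = mk⇔
  (λ iso → Equivalence.from (iso 0F 1F) (s≤s z≤n) ,
           Equivalence.from (iso 1F 3F) (s≤s (s≤s z≤n)) ,
           Equivalence.from (iso 3F 2F) (s≤s (s≤s (s≤s z≤n))))
  (λ (x<y , y<u , u<z) → orderIsomorphic-rearrangement (x ∷ y ∷ z ∷ u ∷ []) p1243
    (increasing x<y y<u u<z) λ { 0F → refl ; 1F → refl ; 2F → refl ; 3F → refl })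

orderIsomorphic-punchIn : ∀ (r : Fin (suc n)) (u : Vec (Fin n) k) (v : Vec (Fin m) k) →
  OrderIsomorphic (Vec.map (punchIn r) u) v ⇔ OrderIsomorphic u v
orderIsomorphic-punchIn r u v = mk⇔
  (λ iso a b → iso a b ⇔-∘ ⇔-sym (punched a b))
  (λ iso a b → iso a b ⇔-∘ punched a b)
  where
  punched : ∀ a b → lookup (Vec.map (punchIn r) u) a Fin.< lookup (Vec.map (punchIn r) u) b ⇔
                    lookup u a Fin.< lookup u b
  punched a b rewrite lookup-map a (punchIn r) u | lookup-map b (punchIn r) u =
    punchIn-< r (lookup u a) (lookup u b)

-- Occurrences that use the new first letter.

-- Adjacency forces an occurrence starting at r to continue with the next two letters; only the
-- fourth can be chosen, among the entries of w.
LeadingOccurrence : Word 4 → Fin (suc m) → (b c : Fin m) → Vec (Fin m) n → Set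
LeadingOccurrence ω r b c w =
  ∃[ j ] OrderIsomorphic (r ∷ punchIn r b ∷ punchIn r c ∷ punchIn r (lookup w j) ∷ []) ω

-- An occurrence that does not start at r lies in the tail, where `punchIn r` leaves the relative
-- order unchanged.
contains-⊕ : ∀ ω (r : Fin (suc (suc (suc n)))) b c w →
  Contains ω (r ⊕ (b ∷ c ∷ w)) ⇔ (LeadingOccurrence ω r b c w ⊎ Contains ω (b ∷ c ∷ w))
contains-⊕ {n} ω r b c w = mk⇔ to from
  where
  v : Word (suc (suc n))
  v = b ∷ c ∷ w

  quadruple : (i i′ i″ j : Fin (suc (suc n))) → Vec (Fin (suc (suc n))) 4
  quadruple i i′ i″ j = lookup v i ∷ lookup v i′ ∷ lookup v i″ ∷ lookup v j ∷ []

  lookup-punched : ∀ i i′ i″ j →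
    lookup (Vec.map (punchIn r) v) i ∷ lookup (Vec.map (punchIn r) v) i′ ∷
    lookup (Vec.map (punchIn r) v) i″ ∷ lookup (Vec.map (punchIn r) v) j ∷ [] ≡
    Vec.map (punchIn r) (quadruple i i′ i″ j)
  lookup-punched i i′ i″ j
    rewrite lookup-map i (punchIn r) v | lookup-map i′ (punchIn r) v
          | lookup-map i″ (punchIn r) v | lookup-map j (punchIn r) v = refl

  to : Contains ω (r ⊕ v) → LeadingOccurrence ω r b c w ⊎ Contains ω v
  to (zero , suc zero , suc (suc zero) , suc (suc (suc j)) , refl , refl , _ , iso) =
    inj₁ (j , subst (λ x → OrderIsomorphic (r ∷ punchIn r b ∷ punchIn r c ∷ x ∷ []) ω)
                    (lookup-map j (punchIn r) w) iso)
  to (zero , suc zero , suc (suc zero) , suc (suc zero) , _ , _ , s≤s (s≤s ()) , _)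
  to (zero , suc zero , suc (suc zero) , suc zero , _ , _ , s≤s () , _)
  to (suc i , suc i′ , suc i″ , suc j , next , next′ , s≤s i″<j , iso) =
    inj₂ (i , i′ , i″ , j , ℕ.suc-injective next , ℕ.suc-injective next′ , i″<j ,
      Equivalence.to (orderIsomorphic-punchIn r (quadruple i i′ i″ j) ω)
        (subst (λ u → OrderIsomorphic u ω) (lookup-punched i i′ i″ j) iso))

  from : LeadingOccurrence ω r b c w ⊎ Contains ω v → Contains ω (r ⊕ v)
  from (inj₁ (j , iso)) = zero , suc zero , suc (suc zero) , suc (suc (suc j)) , refl , refl ,
    s≤s (s≤s (s≤s z≤n)) ,
    subst (λ x → OrderIsomorphic (r ∷ punchIn r b ∷ punchIn r c ∷ x ∷ []) ω)
          (sym (lookup-map j (punchIn r) w)) iso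
  from (inj₂ (i , i′ , i″ , j , next , next′ , i″<j , iso)) =
    suc i , suc i′ , suc i″ , suc j , cong suc next , cong suc next′ , s≤s i″<j ,
    subst (λ u → OrderIsomorphic u ω) (sym (lookup-punched i i′ i″ j))
      (Equivalence.from (orderIsomorphic-punchIn r (quadruple i i′ i″ j) ω) iso)

insertion : ∀ ω al → (∀ κ → T (al desc κ)) →
  (∀ {n} r b c (w : Vec (Fin (suc (suc n))) n) → Unique (b ∷ c ∷ w) →
    (¬ LeadingOccurrence ω r b c w) ⇔
    T (al (compare (suc (toℕ b)) (toℕ c)) (compare (toℕ r) (toℕ b)))) →
  Insertion ω al
insertion ω al after-desc leading zero r (b ∷ []) uniq = mk⇔
  (λ _ → avoids-short (s≤s z≤n) ω (b ∷ []) , after-desc _)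
  (λ _ → avoids-short (s≤s (s≤s z≤n)) ω (r ⊕ (b ∷ [])))
insertion ω al after-desc leading (suc n) r (b ∷ c ∷ w) uniq = mk⇔
  (λ avoids → avoids ∘ Equivalence.from (contains-⊕ ω r b c w) ∘ inj₂ ,
    Equivalence.to (leading r b c w uniq)
      (avoids ∘ Equivalence.from (contains-⊕ ω r b c w) ∘ inj₁))
  (λ (avoids , ok) → Sum.[ Equivalence.from (leading r b c w uniq) ok , avoids ] ∘
    Equivalence.to (contains-⊕ ω r b c w))

-- Leading occurrences in terms of the first three letters.

-- Pigeonhole: if y were missing, `punchOut` at y would give an injection of a set of size n + 1
-- into one of size n.
permutation-surjective : ∀ {w : Word n} → Unique w → ∀ y → ∃[ i ] lookup w i ≡ y
permutation-surjective {suc n} {w} uniq y with Fin.any? (λ i → lookup w i Fin.≟ y)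
... | yes found = found
... | no missing = contradiction (Fin.injective⇒≤ injective) ℕ.1+n≰n
  where
  y≢ : ∀ i → y ≢ lookup w i
  y≢ i y≡ = missing (i , sym y≡)

  injective : ∀ {i j} → punchOut (y≢ i) ≡ punchOut (y≢ j) → i ≡ j
  injective {i} {j} eq = Unique.lookup-injective uniq i j (Fin.punchOut-injective (y≢ i) (y≢ j) eq)

occurs-later : ∀ {b c} {w : Vec (Fin (suc (suc n))) n} → Unique (b ∷ c ∷ w) →
               ∀ y → y ≢ b → y ≢ c → ∃[ j ] lookup w j ≡ y
occurs-later uniq y y≢b y≢c with permutation-surjective uniq y
... | zero        , eq = contradiction (sym eq) y≢b
... | suc zero    , eq = contradiction (sym eq) y≢c
... | suc (suc j) , eq = j , eq

leading-1342 : ∀ {n} r b c (w : Vec (Fin (suc (suc n))) n) → Unique (b ∷ c ∷ w) →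
  LeadingOccurrence p1342 r b c w ⇔ (toℕ r < toℕ b × toℕ b < toℕ c)
leading-1342 {n} r b c w uniq = mk⇔ to from
  where
  to : LeadingOccurrence p1342 r b c w → toℕ r < toℕ b × toℕ b < toℕ c
  to (j , iso) with Equivalence.to orderIsomorphic-1342 iso
  ... | r<d , d<b , b<c =
    ℕ.≤-<-trans (Equivalence.to (r<punchIn⇔r≤ r (lookup w j)) r<d)
                (Equivalence.to (punchIn-< r (lookup w j) b) d<b) ,
    Equivalence.to (punchIn-< r b c) b<c

  from : toℕ r < toℕ b × toℕ b < toℕ c → LeadingOccurrence p1342 r b c w
  from (r<b , b<c) = j , Equivalence.from orderIsomorphic-1342
    ( Equivalence.from (r<punchIn⇔r≤ r _) (ℕ.≤-reflexive (sym d≡r))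
    , Equivalence.from (punchIn-< r _ b) (subst (_< toℕ b) (sym d≡r) r<b)
    , Equivalence.from (punchIn-< r b c) b<c)
    where
    -- The old letter of value r plays the 2: it is raised to r + 1, and it occurs in w since r < b
    -- < c makes it differ from b and c.
    d : Fin (suc (suc n))
    d = Fin.fromℕ< (ℕ.<-trans r<b (Fin.toℕ<n b))

    toℕ-d : toℕ d ≡ toℕ r
    toℕ-d = Fin.toℕ-fromℕ< (ℕ.<-trans r<b (Fin.toℕ<n b))

    d-later : ∃[ j ] lookup w j ≡ d
    d-later = occurs-later uniq d
      (λ d≡b → ℕ.<⇒≢ r<b (trans (sym toℕ-d) (cong toℕ d≡b)))
      (λ d≡c → ℕ.<⇒≢ (ℕ.<-trans r<b b<c) (trans (sym toℕ-d) (cong toℕ d≡c)))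

    j : Fin n
    j = proj₁ d-later

    d≡r : toℕ (lookup w j) ≡ toℕ r
    d≡r = trans (cong toℕ (proj₂ d-later)) toℕ-d

leading-1243 : ∀ {n} r b c (w : Vec (Fin (suc (suc n))) n) → Unique (b ∷ c ∷ w) →
  LeadingOccurrence p1243 r b c w ⇔ (toℕ r ≤ toℕ b × suc (toℕ b) < toℕ c)
leading-1243 {n} r b c w uniq = mk⇔ to from
  where
  to : LeadingOccurrence p1243 r b c w → toℕ r ≤ toℕ b × suc (toℕ b) < toℕ c
  to (j , iso) with Equivalence.to orderIsomorphic-1243 iso
  ... | r<b , b<d , d<c =
    Equivalence.to (r<punchIn⇔r≤ r b) r<b ,
    ℕ.≤-<-trans (Equivalence.to (punchIn-< r b (lookup w j)) b<d)
                (Equivalence.to (punchIn-< r (lookup w j) c) d<c)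

  from : toℕ r ≤ toℕ b × suc (toℕ b) < toℕ c → LeadingOccurrence p1243 r b c w
  from (r≤b , b+1<c) = j , Equivalence.from orderIsomorphic-1243
    ( Equivalence.from (r<punchIn⇔r≤ r b) r≤b
    , Equivalence.from (punchIn-< r b _) (ℕ.≤-reflexive (sym d≡b+1))
    , Equivalence.from (punchIn-< r _ c) (subst (_< toℕ c) (sym d≡b+1) b+1<c))
    where
    -- The old letter of value b + 1 plays the 3: it lies strictly between b and c, so it occurs in
    -- w, and the insertion keeps this order.
    d : Fin (suc (suc n))
    d = Fin.fromℕ< (ℕ.<-trans b+1<c (Fin.toℕ<n c))

    toℕ-d : toℕ d ≡ suc (toℕ b)
    toℕ-d = Fin.toℕ-fromℕ< (ℕ.<-trans b+1<c (Fin.toℕ<n c))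

    d-later : ∃[ j ] lookup w j ≡ d
    d-later = occurs-later uniq d
      (λ d≡b → ℕ.1+n≢n (trans (sym toℕ-d) (cong toℕ d≡b)))
      (λ d≡c → ℕ.<⇒≢ b+1<c (trans (sym toℕ-d) (cong toℕ d≡c)))

    j : Fin n
    j = proj₁ d-later

    d≡b+1 : toℕ (lookup w j) ≡ suc (toℕ b)
    d≡b+1 = trans (cong toℕ (proj₂ d-later)) toℕ-d

-- The two insertion laws and the final count.

-- Comparing b + 1 with c gives `tight` or `loose` exactly when b < c, while r < b is exactly
-- `loose`.
allowed1342-compare : ∀ r b c →
  (¬ (r < b × b < c)) ⇔ T (allowed1342 (compare (suc b) c) (compare r b))
allowed1342-compare r b c
  with compare (suc b) c | comparison (suc b) c | compare r b | comparison r b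
... | _ | desc c≤b  | _ | _         = mk⇔ _ (λ _ (_ , b<c) → ℕ.<⇒≱ b<c (s≤s⁻¹ c≤b))
... | _ | tight b≡c | _ | desc b<r  = mk⇔ _ (λ _ (r<b , _) → ℕ.<-asym r<b b<r)
... | _ | tight b≡c | _ | tight r≡b = mk⇔ _ (λ _ (r<b , _) → ℕ.<⇒≢ r<b r≡b)
... | _ | tight b≡c | _ | loose r<b = mk⇔ (λ ¬p → ¬p (r<b , ℕ.≤-reflexive b≡c)) (λ ())
... | _ | loose b<c | _ | desc b<r  = mk⇔ _ (λ _ (r<b , _) → ℕ.<-asym r<b b<r)
... | _ | loose b<c | _ | tight r≡b = mk⇔ _ (λ _ (r<b , _) → ℕ.<⇒≢ r<b r≡b)
... | _ | loose b<c | _ | loose r<b = mk⇔ (λ ¬p → ¬p (r<b , ℕ.<⇒≤ b<c)) (λ ())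

-- Here b + 1 < c is exactly `loose`, while r ≤ b covers both `tight` and `loose`.
allowed1243-compare : ∀ r b c →
  (¬ (r ≤ b × suc b < c)) ⇔ T (allowed1243 (compare (suc b) c) (compare r b))
allowed1243-compare r b c
  with compare (suc b) c | comparison (suc b) c | compare r b | comparison r b
... | _ | desc c≤b  | _ | _         = mk⇔ _ (λ _ (_ , b<c) → ℕ.<-asym b<c c≤b)
... | _ | tight b≡c | _ | _         = mk⇔ _ (λ _ (_ , b<c) → ℕ.<⇒≢ b<c b≡c)
... | _ | loose b<c | _ | desc b<r  = mk⇔ _ (λ _ (r≤b , _) → ℕ.<⇒≱ b<r r≤b)
... | _ | loose b<c | _ | tight r≡b = mk⇔ (λ ¬p → ¬p (ℕ.≤-reflexive r≡b , b<c)) (λ ())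
... | _ | loose b<c | _ | loose r<b = mk⇔ (λ ¬p → ¬p (ℕ.<⇒≤ r<b , b<c)) (λ ())

insertion-1342 : Insertion p1342 allowed1342
insertion-1342 = insertion p1342 allowed1342 _ λ r b c w uniq →
  allowed1342-compare (toℕ r) (toℕ b) (toℕ c) ⇔-∘ ¬-cong-⇔ (leading-1342 r b c w uniq)

insertion-1243 : Insertion p1243 allowed1243
insertion-1243 = insertion p1243 allowed1243 _ λ r b c w uniq →
  allowed1243-compare (toℕ r) (toℕ b) (toℕ c) ⇔-∘ ¬-cong-⇔ (leading-1243 r b c w uniq)

#avoiders-total : ∀ ω al → Insertion ω al → ∀ n m →
  #avoiders (suc n) ω m ≡ total al n (λ _ _ d → when (does (d ℕ.≟ m)) 1)
#avoiders-total ω al law n m = trans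
  (length-filter (λ π → des π ℕ.≟ m) (𝔖-avoiding (suc n) ω))
  (∑-avoiding ω al law n (λ _ _ d → when (does (d ℕ.≟ m)) 1))

theorem3p7 : p1342 ∼des p1243
theorem3p7 (suc n) _ m = begin
  #avoiders (suc n) p1342 m      ≡⟨ #avoiders-total p1342 allowed1342 insertion-1342 n m ⟩
  -- The weight `counted` sees only the descent number, so it is coarse.
  total allowed1342 n counted    ≡⟨ total-1342≡1243 n counted (λ _ _ → refl) ⟩
  total allowed1243 n counted    ≡⟨ #avoiders-total p1243 allowed1243 insertion-1243 n m ⟨
  #avoiders (suc n) p1243 m      ∎
  where
  counted : Weight
  counted _ _ d = when (does (d ℕ.≟ m)) 1
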